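{- The superintuitionistic logic $\mathsf{Cheq}$ has the disjunction property: for all formulas $\varphi,\psi$ of intuitionistic propositional logic, if $\varphi\vee\psi\in\mathsf{Cheq}$, then $\varphi\in\mathsf{Cheq}$ or $\psi\in\mathsf{Cheq}$.
   Context: Let $\mathfrak{F}_1=\langle W_1,R_1\rangle$ be the 2-fork: $W_1=\{w_0,w_-,w_+\}$, and $R_1$ is the partial order in which every point is related to itself and, besides that, exactly $w_0R_1w_-$ and $w_0R_1w_+$ hold. For $n\ge 1$, $\mathfrak{F}_n=\langle W_1^n,R_n\rangle$ is the $n$-fold product of $\mathfrak{F}_1$ with the componentwise (product) order: $\bar xR_n\bar y$ iff $x_iR_1y_i$ for all $i\in\{1,\dots,n\}$. Formulas are built from propositional variables with $\wedge,\vee,\rightarrow,\bot$, with $\neg\varphi:=\varphi\rightarrow\bot$, and are interpreted on partially ordered Kripke frames by the standard intuitionistic Kripke semantics (valuations assign upward closed sets to variables). A formula is valid in a frame if it holds at every point under every valuation. $\mathsf{Cheq}$ is the set of all formulas valid in every $\mathfrak{F}_n$, $n\ge1$. -}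

module Defs where

open import Level using (0ℓ; suc)
open import Data.Empty using () renaming (⊥ to Empty)
open import Data.Nat using (ℕ; _≥_)
open import Data.Product using (_×_)
open import Data.Sum using (_⊎_)
open import Data.Vec using (Vec)
open import Data.Vec.Relation.Binary.Pointwise.Inductive as Pointwise
  using (Pointwise; []; _∷_)
open import Relation.Binary.Bundles using (Poset)
open import Relation.Binary.Definitions
  using (Transitive; Antisymmetric; _Respects_)
open import Relation.Binary.PropositionalEquality
  using (_≡_; refl; cong₂; isEquivalence)
open import Relation.Unary using (Pred)

infixr 7 _∧_
infixr 6 _∨_
infixr 5 _⇒_

data Formula : Set where
  var         : ℕ → Formula
  ⊥           : Formula
  _∧_ _∨_ _⇒_ : Formula → Formula → Formula

-- `Set`-valued predicates play the role of arbitrary subsets of the carrier.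
-- The resulting notion of validity is the usual classical one once
-- excluded middle is assumed.
record Valuation (F : Poset 0ℓ 0ℓ 0ℓ) : Set₁ where
  open Poset F using (Carrier; _≤_)
  field
    val    : ℕ → Pred Carrier 0ℓ
    upward : ∀ p → val p Respects _≤_

module _ (F : Poset 0ℓ 0ℓ 0ℓ) where
  open Poset F using (Carrier; _≤_)

  Forces : Valuation F → Carrier → Formula → Set
  Forces V w (var p) = Valuation.val V p w
  Forces V w ⊥       = Empty
  Forces V w (φ ∧ ψ) = Forces V w φ × Forces V w ψ
  Forces V w (φ ∨ ψ) = Forces V w φ ⊎ Forces V w ψ
  Forces V w (φ ⇒ ψ) = ∀ v → w ≤ v → Forces V v φ → Forces V v ψ

  Valid : Formula → Set₁
  Valid φ = ∀ (V : Valuation F) w → Forces V w φ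

data W₁ : Set where
  w₀ w₋ w₊ : W₁

data R₁ : W₁ → W₁ → Set where
  R-refl : ∀ {x} → R₁ x x
  w₀Rw₋  : R₁ w₀ w₋
  w₀Rw₊  : R₁ w₀ w₊

R₁-trans : Transitive R₁
R₁-trans R-refl q      = q
R₁-trans w₀Rw₋  R-refl = w₀Rw₋
R₁-trans w₀Rw₊  R-refl = w₀Rw₊

R₁-antisym : Antisymmetric _≡_ R₁
R₁-antisym R-refl _ = refl

R : ∀ n → Vec W₁ n → Vec W₁ n → Set
R n x y = Pointwise R₁ x y

R-antisym : ∀ {n} → Antisymmetric _≡_ (R n)
R-antisym []       []       = refl
R-antisym (p ∷ ps) (q ∷ qs) = cong₂ Vec._∷_ (R₁-antisym p q) (R-antisym ps qs)

𝔉 : ℕ → Poset 0ℓ 0ℓ 0ℓ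
𝔉 n = record
  { Carrier        = Vec W₁ n
  ; _≈_            = _≡_
  ; _≤_            = R n
  ; isPartialOrder = record
    { isPreorder = record
      { isEquivalence = isEquivalence
      ; reflexive     = λ { refl → Pointwise.refl R-refl }
      ; trans         = Pointwise.trans R₁-trans
      }
    ; antisym = R-antisym
    }
  }

Cheq : Pred Formula (suc 0ℓ)
Cheq φ = ∀ n → n ≥ 1 → Valid (𝔉 n) φ

{-# OPTIONS --safe #-}

-- Any two countermodels, on 𝔉 n and 𝔉 m, combine into one on 𝔉 (1 + (n + m)):
-- above w₋ in the first coordinate pull back the first model along the projection to the
-- next n coordinates, above w₊ pull back the second model along the projection to the last m,
-- and make all variables false at w₀.  The two halves are disjoint upsets, so this is an
-- upward closed valuation, and a disjunction true at (w₀, z) has a disjunct that persists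
-- to (w₋, z) or (w₊, z).

module Submission where

open import Defs
open import Level using (0ℓ; suc; lift; lower)
open import Axiom.ExcludedMiddle using (ExcludedMiddle)
open import Data.Empty using () renaming (⊥ to Empty)
open import Data.Nat using (ℕ; _+_; s≤s; z≤n)
open import Data.Product using (_×_; _,_; ∃-syntax; map)
open import Data.Sum as Sum using (_⊎_; inj₁; inj₂; [_,_]′)
open import Data.Vec using (Vec; _∷_; _++_; take; drop)
open import Data.Vec.Properties using (take++drop≡id; ++-injectiveˡ; ++-injectiveʳ)
open import Data.Vec.Relation.Binary.Pointwise.Inductive as Pointwise
  using (_∷_; ++⁺; ++ˡ⁻; ++ʳ⁻)
open import Function using (id; _∘_)
open import Relation.Binary.Bundles using (Poset)
open import Relation.Binary.PropositionalEquality
  using (_≡_; refl; sym; subst; subst₂)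
open import Relation.Nullary using (yes; no; contradiction)
open import Relation.Nullary.Decidable using (map′; decidable-stable)
open import Relation.Unary using (_∈_)

Forces-upward : (F : Poset 0ℓ 0ℓ 0ℓ) (V : Valuation F) (φ : Formula) →
                let open Poset F in
                ∀ {w v} → w ≤ v → Forces F V w φ → Forces F V v φ
Forces-upward F V (var p) w≤v h = Valuation.upward V p w≤v h
Forces-upward F V (φ ∧ ψ) w≤v h =
  map (Forces-upward F V φ w≤v) (Forces-upward F V ψ w≤v) h
Forces-upward F V (φ ∨ ψ) w≤v h =
  Sum.map (Forces-upward F V φ w≤v) (Forces-upward F V ψ w≤v) h
Forces-upward F V (φ ⇒ ψ) w≤v h u v≤u = h u (Poset.trans F w≤v v≤u)

-- A relation, not a map, so that the projections can be used although they preserve truth only on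
-- part of the glued frame.
record Bisimulation {F G : Poset 0ℓ 0ℓ 0ℓ} (V : Valuation F) (U : Valuation G) : Set₁ where
  private
    module F = Poset F
    module G = Poset G
  field
    _∼_   : F.Carrier → G.Carrier → Set
    atom→ : ∀ {x y} p → x ∼ y → Valuation.val V p x → Valuation.val U p y
    atom← : ∀ {x y} p → x ∼ y → Valuation.val U p y → Valuation.val V p x
    forth : ∀ {x y x′} → x ∼ y → x F.≤ x′ → ∃[ y′ ] y G.≤ y′ × x′ ∼ y′
    back  : ∀ {x y y′} → x ∼ y → y G.≤ y′ → ∃[ x′ ] x F.≤ x′ × x′ ∼ y′

  mutual
    -- Implication is contravariant in its premise, so the two directions of transfer need one
    -- simultaneous induction.
    Forces→ : ∀ {x y} φ → x ∼ y → Forces F V x φ → Forces G U y φ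
    Forces→ (var p) x∼y = atom→ p x∼y
    Forces→ (φ ∧ ψ) x∼y = map (Forces→ φ x∼y) (Forces→ ψ x∼y)
    Forces→ (φ ∨ ψ) x∼y = Sum.map (Forces→ φ x∼y) (Forces→ ψ x∼y)
    Forces→ (φ ⇒ ψ) x∼y h y′ y≤y′ hφ with back x∼y y≤y′
    ... | x′ , x≤x′ , x′∼y′ = Forces→ ψ x′∼y′ (h x′ x≤x′ (Forces← φ x′∼y′ hφ))

    Forces← : ∀ {x y} φ → x ∼ y → Forces G U y φ → Forces F V x φ
    Forces← (var p) x∼y = atom← p x∼y
    Forces← (φ ∧ ψ) x∼y = map (Forces← φ x∼y) (Forces← ψ x∼y)
    Forces← (φ ∨ ψ) x∼y = Sum.map (Forces← φ x∼y) (Forces← ψ x∼y)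
    Forces← (φ ⇒ ψ) x∼y h x′ x≤x′ hφ with forth x∼y x≤x′
    ... | y′ , y≤y′ , x′∼y′ = Forces← ψ x′∼y′ (h y′ y≤y′ (Forces→ φ x′∼y′ hφ))

take-++ : ∀ {A : Set} {m} n (xs : Vec A n) (ys : Vec A m) → take n (xs ++ ys) ≡ xs
take-++ n xs ys = ++-injectiveˡ (take n (xs ++ ys)) xs (take++drop≡id n (xs ++ ys))

drop-++ : ∀ {A : Set} {m} n (xs : Vec A n) (ys : Vec A m) → drop n (xs ++ ys) ≡ ys
drop-++ n xs ys = ++-injectiveʳ (take n (xs ++ ys)) xs (take++drop≡id n (xs ++ ys))

R-refl* : ∀ {n} {x : Vec W₁ n} → R n x x
R-refl* = Pointwise.refl R-refl

module _ n {m} {x y : Vec W₁ (n + m)} (x≤y : R (n + m) x y) where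
  private
    split : R (n + m) (take n x ++ drop n x) (take n y ++ drop n y)
    split = subst₂ (R (n + m)) (sym (take++drop≡id n x)) (sym (take++drop≡id n y)) x≤y

  take-mono : R n (take n x) (take n y)
  take-mono = ++ˡ⁻ (take n x) (take n y) split

  drop-mono : R m (drop n x) (drop n y)
  drop-mono = ++ʳ⁻ (take n x) (take n y) split

module _ n {m} (z : Vec W₁ (n + m)) where

  ≤-replace-take : ∀ {y} → R n (take n z) y → R (n + m) z (y ++ drop n z)
  ≤-replace-take {y} h =
    subst (λ u → R (n + m) u (y ++ drop n z)) (take++drop≡id n z) (++⁺ h R-refl*)

  ≤-replace-drop : ∀ {y} → R m (drop n z) y → R (n + m) z (take n z ++ y)
  ≤-replace-drop {y} h =
    subst (λ u → R (n + m) u (take n z ++ y)) (take++drop≡id n z) (++⁺ R-refl* h)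

module Gluing {n m} (V : Valuation (𝔉 n)) (U : Valuation (𝔉 m)) where

  glued-val : ℕ → Vec W₁ (ℕ.suc (n + m)) → Set
  glued-val p (w₀ ∷ z) = Empty
  glued-val p (w₋ ∷ z) = Valuation.val V p (take n z)
  glued-val p (w₊ ∷ z) = Valuation.val U p (drop n z)

  glued : Valuation (𝔉 (ℕ.suc (n + m)))
  glued = record { val = glued-val ; upward = glued-upward }
    where
    glued-upward : ∀ p {x y} → R _ x y → glued-val p x → glued-val p y
    -- Since `w₋` and `w₊` are maximal, the head cannot change; at head `w₀` the premise is empty.
    glued-upward p {w₋ ∷ _} (R-refl ∷ x≤y) = Valuation.upward V p (take-mono n x≤y)
    glued-upward p {w₊ ∷ _} (R-refl ∷ x≤y) = Valuation.upward U p (drop-mono n x≤y)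

  -- The graph of a projection restricted to an upset: `forth` holds by monotonicity and maximality
  -- of `w₋`.
  left : Bisimulation glued V
  left = record
    { _∼_   = λ x y → ∃[ z ] x ≡ w₋ ∷ z × take n z ≡ y
    ; atom→ = λ { p (z , refl , refl) h → h }
    ; atom← = λ { p (z , refl , refl) h → h }
    ; forth = λ { (z , refl , refl) (R-refl ∷ z≤z′) →
                  _ , take-mono n z≤z′ , _ , refl , refl }
    ; back  = λ { {y′ = y′} (z , refl , refl) y≤y′ →
                  -- Move only the first block; the other coordinates stay put.
                  w₋ ∷ (y′ ++ drop n z)
                  , R-refl ∷ ≤-replace-take n z y≤y′
                  , _ , refl , take-++ n y′ (drop n z) }
    }

  right : Bisimulation glued U
  right = record
    { _∼_   = λ x y → ∃[ z ] x ≡ w₊ ∷ z × drop n z ≡ y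
    ; atom→ = λ { p (z , refl , refl) h → h }
    ; atom← = λ { p (z , refl , refl) h → h }
    ; forth = λ { (z , refl , refl) (R-refl ∷ z≤z′) →
                  _ , drop-mono n z≤z′ , _ , refl , refl }
    ; back  = λ { {y′ = y′} (z , refl , refl) y≤y′ →
                  w₊ ∷ (take n z ++ y′)
                  , R-refl ∷ ≤-replace-drop n z y≤y′
                  , _ , refl , drop-++ n (take n z) y′ }
    }

Cheq-∨-pointwise : ∀ φ ψ → (φ ∨ ψ) ∈ Cheq →
                   ∀ {n m} (V : Valuation (𝔉 n)) (U : Valuation (𝔉 m)) x y →
                   Forces (𝔉 n) V x φ ⊎ Forces (𝔉 m) U y ψ
Cheq-∨-pointwise φ ψ φ∨ψ {n} {m} V U x y =
  Sum.map
    (Bisimulation.Forces→ left φ (x ++ y , refl , take-++ n x y)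
      ∘ Forces-upward (𝔉 _) glued φ (w₀Rw₋ ∷ R-refl*))
    (Bisimulation.Forces→ right ψ (x ++ y , refl , drop-++ n x y)
      ∘ Forces-upward (𝔉 _) glued ψ (w₀Rw₊ ∷ R-refl*))
    -- The extra coordinate makes the dimension positive, and `x ++ y` projects onto both chosen
    -- points.
    (φ∨ψ _ (s≤s z≤n) glued (w₀ ∷ (x ++ y)))
  where open Gluing V U

theorem1 : ExcludedMiddle (suc 0ℓ) →
           (φ ψ : Formula) → (φ ∨ ψ) ∈ Cheq → (φ ∈ Cheq) ⊎ (ψ ∈ Cheq)
theorem1 em φ ψ φ∨ψ with em {φ ∈ Cheq}
... | yes φ∈Cheq = inj₁ φ∈Cheq
... | no  φ∉Cheq = inj₂ λ m _ U y →
  -- Forcing lives in `Set`, so it is lifted to the level of `em`. A single point refuting `ψ`,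
  -- paired with every point of every model, would force `φ` everywhere.
  decidable-stable (map′ lower (lift {ℓ = suc 0ℓ}) em) λ ¬ψ →
    φ∉Cheq λ n _ V x →
      [ id , (λ hψ → contradiction hψ ¬ψ) ]′ (Cheq-∨-pointwise φ ψ φ∨ψ V U x y)
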